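{- Let $\mathbb{Q}_0,\mathbb{Q}_1$ be posets, $D_0$ a non-principal ultrafilter on $\omega$, and $Q_0\subseteq\mathbb{Q}_0$, $Q_1\subseteq\mathbb{Q}_1$ be $D_0$-linked subsets. Then $Q_0\times Q_1$ is $D_0$-linked in $\mathbb{Q}_0\times\mathbb{Q}_1$. In particular: (a) for any infinite cardinal $\mu$, the product of two $\mu$-$D_0$-linked posets is $\mu$-$D_0$-linked; (b) if $\theta$ is regular, the product of two $\theta$-$D_0$-Knaster posets is $\theta$-$D_0$-Knaster. The analogous statements hold with "uf-linked" in place of "$D_0$-linked" and "uf-Knaster" in place of "$D_0$-Knaster".
   Context: For a poset $\mathbb{P}$ and $\bar p=\langle p_n:n<\omega\rangle$ in $\mathbb{P}$, $\dot W(\bar p)$ names $\{n:p_n\in\dot G\}$. For a filter $F$ on $\omega$ containing the cofinite sets, $F^+$ is the family of subsets of $\omega$ meeting every member of $F$. $Q\subseteq\mathbb{P}$ is $F$-linked if for every sequence $\bar p$ in $Q$ there is $q\in\mathbb{P}$ forcing $\dot W(\bar p)\in F^+$; $Q$ is uf-linked if it is $D$-linked for every non-principal ultrafilter $D$ on $\omega$. $\mathbb{P}$ is $\mu$-$F$-linked ($\mu$-uf-linked) if it is the union of $\mu$ many $F$-linked (uf-linked) subsets; $\mathbb{P}$ is $\theta$-$F$-Knaster ($\theta$-uf-Knaster) if every subset of size $\theta$ contains an $F$-linked (uf-linked) subset of size $\theta$. -}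

module Defs where

open import Level using (Level; suc; _⊔_)
open import Data.Nat.Base using (ℕ)
open import Data.Product.Base using (Σ-syntax; ∃-syntax; _×_)
open import Data.Sum.Base using (_⊎_)
open import Function.Bundles using (_⇔_; _↣_)
open import Function.Definitions using (Injective)
open import Induction.WellFounded using (WellFounded)
open import Relation.Binary.Bundles using (Poset; Setoid)
open import Relation.Binary.Core using (Rel)
open import Relation.Binary.PropositionalEquality using (_≡_; setoid)
open import Relation.Binary.Structures using (IsStrictTotalOrder)
open import Relation.Nullary.Negation using (¬_)
open import Relation.Unary using (Pred; Empty; _∈_; _∉_; _⊆_; _∩_; ∁)

-- Set ℓ plays the role of the universe of sets: posets and cardinals live in
-- Set ℓ and the subsets of X are the elements of Pred X ℓ.

Family : (ℓ : Level) → Set (suc ℓ)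
Family ℓ = Pred (Pred ℕ ℓ) ℓ

record IsFilter {ℓ : Level} (F : Family ℓ) : Set (suc ℓ) where
  field
    nonempty : ∃[ A ] A ∈ F
    proper   : ∀ {A} → Empty A → A ∉ F
    upward   : ∀ {A B} → A ⊆ B → A ∈ F → B ∈ F
    ∩-closed : ∀ {A B} → A ∈ F → B ∈ F → (A ∩ B) ∈ F

record IsNonPrincipalUltrafilter {ℓ : Level} (D : Family ℓ) : Set (suc ℓ) where
  field
    isFilter     : IsFilter D
    ultra        : ∀ A → A ∈ D ⊎ ∁ A ∈ D
    nonPrincipal : ¬ (Σ[ B ∈ Pred ℕ ℓ ] (∀ A → A ∈ D ⇔ B ⊆ A))

HasSize : {ℓ : Level} (S : Setoid ℓ ℓ) → Pred (Setoid.Carrier S) ℓ → Set ℓ → Set ℓ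
HasSize S A X = Σ[ f ∈ (X → Carrier) ]
                  (∀ x → f x ∈ A)
                  × Injective _≡_ _≈_ f
                  × (∀ {a} → a ∈ A → ∃[ x ] f x ≈ a)
  where open Setoid S using (Carrier; _≈_)

-- A cardinal is an initial ordinal: a well-order not equinumerous with any of
-- its proper initial segments.
record Cardinal (ℓ : Level) : Set (suc ℓ) where
  infix 4 _<_
  field
    Carrier            : Set ℓ
    _<_                : Rel Carrier ℓ
    isStrictTotalOrder : IsStrictTotalOrder _≡_ _<_
    wellFounded        : WellFounded _<_
    initial            : ∀ β → ¬ HasSize (setoid Carrier) (_< β) Carrier

IsInfinite : {ℓ : Level} → Cardinal ℓ → Set ℓ
IsInfinite κ = ℕ ↣ Cardinal.Carrier κ

-- cf θ = θ: no map from some β < θ to θ has cofinal range. A map defined on β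
-- only is represented by any of its extensions to θ.
IsRegular : {ℓ : Level} → Cardinal ℓ → Set ℓ
IsRegular θ = IsInfinite θ
            × (∀ β (f : Carrier → Carrier) → ∃[ γ ] (∀ {ξ} → ξ < β → f ξ < γ))
  where open Cardinal θ

module Forcing {ℓ : Level} (P : Poset ℓ ℓ ℓ) where

  open Poset P using (Carrier; _≤_; module Eq)

  -- q ≤ p means that q is the stronger condition.
  DenseBelow : ∀ {a} → Carrier → Pred Carrier a → Set (ℓ ⊔ a)
  DenseBelow q X = ∀ {r} → r ≤ q → ∃[ s ] s ≤ r × s ∈ X

  -- A sentence of the forcing language is represented by the set of conditions
  -- forcing it; the operations below are the clauses of the recursive
  -- definition of the forcing relation (bounded quantifiers range over
  -- members of a ground model set).
  Sentence : (a : Level) → Set (ℓ ⊔ suc a)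
  Sentence a = Pred Carrier a

  infix 4 _⊩_
  _⊩_ : ∀ {a} → Carrier → Sentence a → Set a
  q ⊩ φ = q ∈ φ

  _∈Ġ : Carrier → Sentence ℓ
  (p ∈Ġ) q = DenseBelow q (_≤ p)

  ⋀ : ∀ {i a b} {I : Set i} → Pred I b → (I → Sentence a) → Sentence (i ⊔ a ⊔ b)
  ⋀ X φ q = ∀ i → i ∈ X → q ⊩ φ i

  ⋁ : ∀ {i a b} {I : Set i} → Pred I b → (I → Sentence a) → Sentence (ℓ ⊔ i ⊔ a ⊔ b)
  ⋁ X φ q = DenseBelow q (λ s → ∃[ i ] i ∈ X × (s ⊩ φ i))

  -- A name τ for a subset of ω is given by the sentences τ n, "n ∈ τ".
  Nameω : Set (suc ℓ)
  Nameω = ℕ → Sentence ℓ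

  Ẇ : (ℕ → Carrier) → Nameω
  Ẇ p n = p n ∈Ġ

  -- "τ ∈ F⁺", i.e. ∀ a ∈ F. ∃ n ∈ a. n ∈ τ.
  _∈⁺_ : Nameω → Family ℓ → Sentence (suc ℓ)
  τ ∈⁺ F = ⋀ F (λ a → ⋁ a τ)

  Linked : Family ℓ → Pred Carrier ℓ → Set (suc ℓ)
  Linked F Q = ∀ (p : ℕ → Carrier) → (∀ n → p n ∈ Q) → ∃[ q ] (q ⊩ Ẇ p ∈⁺ F)

  UfLinked : Pred Carrier ℓ → Set (suc ℓ)
  UfLinked Q = ∀ D → IsNonPrincipalUltrafilter D → Linked D Q

  CoveredBy : ∀ {a} → Cardinal ℓ → Pred (Pred Carrier ℓ) a → Set (suc ℓ ⊔ a)
  CoveredBy μ 𝓛 = Σ[ Q ∈ (Cardinal.Carrier μ → Pred Carrier ℓ) ]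
                    (∀ i → Q i ∈ 𝓛) × (∀ p → ∃[ i ] p ∈ Q i)

  -- Sizes are computed modulo the equality _≈_ of P.
  Knaster : ∀ {a} → Cardinal ℓ → Pred (Pred Carrier ℓ) a → Set (suc ℓ ⊔ a)
  Knaster θ 𝓛 = ∀ (A : Pred Carrier ℓ) → HasSize Eq.setoid A (Cardinal.Carrier θ) →
                  ∃[ B ] B ⊆ A × HasSize Eq.setoid B (Cardinal.Carrier θ) × B ∈ 𝓛

  μ-Linked : Cardinal ℓ → Family ℓ → Set (suc ℓ)
  μ-Linked μ F = CoveredBy μ (Linked F)

  μ-UfLinked : Cardinal ℓ → Set (suc ℓ)
  μ-UfLinked μ = CoveredBy μ UfLinked

  θ-Knaster : Cardinal ℓ → Family ℓ → Set (suc ℓ)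
  θ-Knaster θ F = Knaster θ (Linked F)

  θ-UfKnaster : Cardinal ℓ → Set (suc ℓ)
  θ-UfKnaster θ = Knaster θ UfLinked

{-# OPTIONS --safe #-}

-- If q forces Ẇ(p) ∈ D⁺ and r ≤ q, then {n : r is compatible with p n} meets
-- every member of the ultrafilter D, so it belongs to D.  Given r₀ and r₁ in
-- the two factors, the two sets in D intersect, and a common n yields an
-- extension of (r₀ , r₁) below (p₀ n , p₁ n).
--
-- (a) then follows from μ · μ = μ.  For (b), when θ is regular, every map on θ is
-- constant or injective on a set of size θ; applying this to one coordinate
-- after the other, the first case gives a singleton, which is linked, and the
-- second a set of size θ to which the Knaster property applies.
module Submission where

open import Defs
open import Level using (Level; suc; Lift; lift)
open import Axiom.ExcludedMiddle using (ExcludedMiddle)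
open import Data.Empty using (⊥-elim)
open import Data.Nat.Base as ℕ using (ℕ)
import Data.Nat.Properties as ℕ
open import Data.Product.Base using (Σ-syntax; ∃-syntax; _×_; _,_; proj₁; proj₂)
open import Data.Product.Properties using (,-injectiveʳ)
open import Data.Product.Relation.Binary.Lex.Strict using (×-Lex; ×-wellFounded)
open import Data.Product.Relation.Binary.Pointwise.NonDependent using (×-poset)
open import Data.Sum.Base using (_⊎_; inj₁; inj₂; [_,_]′)
open import Function.Base using (_∘_; _on_)
open import Function.Bundles using (Injection)
open import Function.Definitions using (Injective)
open import Induction.WellFounded using (WellFounded; WfRec; module All; module FixPoint)
open import Relation.Binary.Bundles using (Poset; Setoid)
open import Relation.Binary.Core using (Rel)
open import Relation.Binary.Definitions using (tri<; tri≈; tri>)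
import Relation.Binary.Construct.On as On
open import Relation.Binary.PropositionalEquality using (_≡_; refl; sym; trans; cong; cong₂; subst)
open import Relation.Binary.Structures using (IsStrictTotalOrder)
open import Relation.Nullary using (¬_; yes; no; contradiction)
open import Relation.Nullary.Decidable using (map′; decidable-stable)
open import Relation.Unary using (Pred; _∈_; _∉_; _⊆_; _∩_; _≐_; _⟨×⟩_)
open import Relation.Unary.Polymorphic using (U)

private
  variable
    ℓ : Level

-- Well-orders and comparison of sizes

record WellOrder (X : Set ℓ) : Set (suc ℓ) where
  infix 4 _<_
  field
    _<_         : Rel X ℓ
    wellFounded : WellFounded _<_
    connex      : ∀ x y → x < y ⊎ x ≡ y ⊎ y < x

lexicographic : {X Y : Set ℓ} → WellOrder X → WellOrder Y → WellOrder (X × Y)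
lexicographic V W = record
  { _<_         = ×-Lex _≡_ V._<_ W._<_
  ; wellFounded = ×-wellFounded V.wellFounded W.wellFounded
  ; connex      = connex
  }
  where
  module V = WellOrder V
  module W = WellOrder W
  connex : ∀ p q → ×-Lex _≡_ V._<_ W._<_ p q ⊎ p ≡ q ⊎ ×-Lex _≡_ V._<_ W._<_ q p
  connex (x , y) (x′ , y′) with V.connex x x′
  ... | inj₁ x<x′        = inj₁ (inj₁ x<x′)
  ... | inj₂ (inj₂ x′<x) = inj₂ (inj₂ (inj₁ x′<x))
  ... | inj₂ (inj₁ refl) with W.connex y y′
  ...   | inj₁ y<y′        = inj₁ (inj₂ (refl , y<y′))
  ...   | inj₂ (inj₁ refl) = inj₂ (inj₁ refl)
  ...   | inj₂ (inj₂ y′<y) = inj₂ (inj₂ (inj₂ (refl , y′<y)))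

pullback : {X Y : Set ℓ} (f : X → Y) → Injective _≡_ _≡_ f → WellOrder Y → WellOrder X
pullback f f-inj W = record
  { _<_         = W._<_ on f
  ; wellFounded = On.wellFounded f W.wellFounded
  ; connex      = λ x y → [ inj₁ , [ inj₂ ∘ inj₁ ∘ f-inj , inj₂ ∘ inj₂ ]′ ]′ (W.connex (f x) (f y))
  }
  where module W = WellOrder W

-- The value may depend on the proof of x ∈ A; only distinct points have to be
-- sent to distinct values.
infix 4 _≼_
record _≼_ {X Y : Set ℓ} (A : Pred X ℓ) (B : Pred Y ℓ) : Set ℓ where
  field
    to     : ∀ {x} → x ∈ A → Y
    to-∈   : ∀ {x} (x∈A : x ∈ A) → to x∈A ∈ B
    to-inj : ∀ {x y} (x∈A : x ∈ A) (y∈A : y ∈ A) → to x∈A ≡ to y∈A → x ≡ y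

open _≼_

≼-trans : {X Y Z : Set ℓ} {A : Pred X ℓ} {B : Pred Y ℓ} {C : Pred Z ℓ} → A ≼ B → B ≼ C → A ≼ C
≼-trans f g = record
  { to     = to g ∘ to-∈ f
  ; to-∈   = to-∈ g ∘ to-∈ f
  ; to-inj = λ p q → to-inj f p q ∘ to-inj g (to-∈ f p) (to-∈ f q)
  }

⊆⇒≼ : {X : Set ℓ} {A B : Pred X ℓ} → A ⊆ B → A ≼ B
⊆⇒≼ A⊆B = record
  { to     = λ {x} _ → x
  ; to-∈   = A⊆B
  ; to-inj = λ _ _ eq → eq
  }

square-mono : {X Y : Set ℓ} {A : Pred X ℓ} {B : Pred Y ℓ} → A ≼ B → (A ⟨×⟩ A) ≼ (B ⟨×⟩ B)
square-mono f = record
  { to     = λ (p , q) → to f p , to f q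
  ; to-∈   = λ (p , q) → to-∈ f p , to-∈ f q
  ; to-inj = λ (p , q) (p′ , q′) eq →
      cong₂ _,_ (to-inj f p p′ (cong proj₁ eq)) (to-inj f q q′ (cong proj₂ eq))
  }

lower-em : ExcludedMiddle (suc ℓ) → ExcludedMiddle ℓ
lower-em {ℓ} em {P} = map′ Level.lower lift (em {Lift (suc ℓ) P})

module Least (em : ExcludedMiddle ℓ) {Y : Set ℓ} (W : WellOrder Y) (default : Y) where
  open WellOrder W

  IsLeast : Pred Y ℓ → Pred Y ℓ
  IsLeast J m = m ∈ J × (∀ {y} → y < m → y ∉ J)

  least-exists : ∀ {J y} → y ∈ J → ∃[ m ] IsLeast J m
  least-exists {J} {y} = All.wfRec wellFounded ℓ (λ y → y ∈ J → ∃[ m ] IsLeast J m) step y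
    where
    step : ∀ y → WfRec _<_ (λ y → y ∈ J → ∃[ m ] IsLeast J m) y → y ∈ J → ∃[ m ] IsLeast J m
    step y rec y∈J with em {∃[ z ] z < y × z ∈ J}
    ... | yes (z , z<y , z∈J) = rec z<y z∈J
    ... | no none             = y , y∈J , λ z<y z∈J → none (_ , z<y , z∈J)

  -- The value `default` on empty predicates makes this total, so that the recursion in `Comparison`
  -- can be written down before anything is known to be free.
  least : Pred Y ℓ → Y
  least J with em {∃[ m ] IsLeast J m}
  ... | yes (m , _) = m
  ... | no _        = default

  least-∈ : ∀ J {y} → y ∈ J → least J ∈ J
  least-∈ J y∈J with em {∃[ m ] IsLeast J m}
  ... | yes (_ , m∈J , _) = m∈J
  ... | no none           = contradiction (least-exists y∈J) none

  -- Connexity identifies two least elements of equivalent predicates. Unfolding a well-founded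
  -- recursion requires a step that respects pointwise equality, and this supplies it for
  -- `Comparison`.
  least-cong : ∀ {J K} → J ≐ K → least J ≡ least K
  least-cong {J} {K} (J⊆K , K⊆J) with em {∃[ m ] IsLeast J m} | em {∃[ m ] IsLeast K m}
  ... | no _  | no _  = refl
  ... | no ¬J | yes (_ , m∈K , _) = contradiction (least-exists (K⊆J m∈K)) ¬J
  ... | yes (_ , m∈J , _) | no ¬K = contradiction (least-exists (J⊆K m∈J)) ¬K
  ... | yes (m , m∈J , m-min) | yes (n , n∈K , n-min) with connex m n
  ...   | inj₁ m<n        = contradiction (J⊆K m∈J) (n-min m<n)
  ...   | inj₂ (inj₁ m≡n) = m≡n
  ...   | inj₂ (inj₂ n<m) = contradiction (K⊆J n∈K) (m-min n<m)

-- Send each x ∈ A to the least element of B not yet taken; this can only get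
-- stuck at x if the values taken below x exhaust B.
module Comparison (em : ExcludedMiddle ℓ) {X Y : Set ℓ} (V : WellOrder X) (W : WellOrder Y)
                  (default : Y) (A : Pred X ℓ) (B : Pred Y ℓ) where
  private
    module V = WellOrder V
    open Least em W default

    Free : ∀ x → WfRec V._<_ (λ _ → Y) x → Pred Y ℓ
    Free x f y = y ∈ B × ¬ (∃[ v ] Σ[ v<x ∈ v V.< x ] v ∈ A × f v<x ≡ y)

    Free-cong : ∀ x {f g : WfRec V._<_ (λ _ → Y) x} →
                (∀ {v} (v<x : v V.< x) → f v<x ≡ g v<x) → Free x f ⊆ Free x g
    Free-cong x f≗g (y∈B , free) =
      y∈B , λ (v , v<x , v∈A , eq) → free (v , v<x , v∈A , trans (f≗g v<x) eq)

    step : ∀ x → WfRec V._<_ (λ _ → Y) x → Y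
    step x f = least (Free x f)

    step-cong : ∀ x {f g : WfRec V._<_ (λ _ → Y) x} →
                (∀ {v} (v<x : v V.< x) → f v<x ≡ g v<x) → step x f ≡ step x g
    step-cong x f≗g = least-cong (Free-cong x f≗g , Free-cong x (sym ∘ f≗g))

    -- Its values outside `A` are irrelevant, since `Free` counts only those taken at points of `A`.
    h : X → Y
    h = All.wfRec V.wellFounded ℓ (λ _ → Y) step

    h-unfold : ∀ x → h x ≡ least (Free x (λ {v} _ → h v))
    h-unfold x = FixPoint.unfold-wfRec V.wellFounded (λ _ → Y) step step-cong {x}

  compare : A ≼ B ⊎ ∃[ x ] x ∈ A × B ≼ A ∩ (V._< x)
  compare with em {∃[ x ] x ∈ A × B ≼ A ∩ (V._< x)}
  ... | yes stuck   = inj₂ stuck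
  ... | no  unstuck = inj₁ record
    { to     = λ {x} _ → h x
    ; to-∈   = λ x∈A → proj₁ (h-free x∈A)
    ; to-inj = h-inj
    }
    where
    -- Otherwise every element of `B` is taken below `x`; sending it to a point where it is taken
    -- embeds `B`, because `h` has one value at each point.
    free-exists : ∀ {x} → x ∈ A → ∃[ y ] y ∈ Free x (λ {v} _ → h v)
    free-exists {x} x∈A = decidable-stable em λ none →
      let hit : ∀ {y} → y ∈ B → ∃[ v ] Σ[ v<x ∈ v V.< x ] v ∈ A × h v ≡ y
          hit y∈B = decidable-stable em λ free → none (_ , y∈B , free)
      in unstuck (x , x∈A , record
        { to     = proj₁ ∘ hit
        ; to-∈   = λ y∈B → let (_ , v<x , v∈A , _) = hit y∈B in v∈A , v<x
        ; to-inj = λ y∈B z∈B eq →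
            let (_ , _ , _ , hv≡y) = hit y∈B
                (_ , _ , _ , hw≡z) = hit z∈B
            in trans (sym hv≡y) (trans (cong h eq) hw≡z)
        })

    h-free : ∀ {x} → x ∈ A → h x ∈ Free x (λ {v} _ → h v)
    h-free {x} x∈A = subst (_∈ Free x (λ {v} _ → h v)) (sym (h-unfold x))
                       (least-∈ (Free x (λ {v} _ → h v)) (proj₂ (free-exists x∈A)))

    h-inj : ∀ {x y} → x ∈ A → y ∈ A → h x ≡ h y → x ≡ y
    h-inj {x} {y} x∈A y∈A eq with V.connex x y
    ... | inj₁ x<y        = contradiction (x , x<y , x∈A , eq) (proj₂ (h-free y∈A))
    ... | inj₂ (inj₁ x≡y) = x≡y
    ... | inj₂ (inj₂ y<x) = contradiction (y , y<x , y∈A , sym eq) (proj₂ (h-free x∈A))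

-- κ · κ = κ

module _ where
  open import Data.Nat.Base using (_+_; _*_; _≤_; _<_)
  open import Data.Nat.Tactic.RingSolver using (solve-∀)
  open ℕ.≤-Reasoning

  -- Cantor's pairing with squares in place of triangular numbers: if `m + n` is `s`, the value lies
  -- between `s * s` and `s * s + s`, hence below the square of `s + 1`.
  pair : ℕ × ℕ → ℕ
  pair (m , n) = (m + n) * (m + n) + m

  private
    pair-mono : ∀ m n m′ n′ → m + n < m′ + n′ → pair (m , n) < pair (m′ , n′)
    pair-mono m n m′ n′ lt = begin-strict
      s * s + m               ≤⟨ ℕ.+-monoʳ-≤ (s * s) (ℕ.m≤m+n m n) ⟩
      s * s + s               <⟨ ℕ.+-monoʳ-< (s * s) (ℕ.s≤s (ℕ.m≤m+n s s)) ⟩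
      s * s + (1 + (s + s))   ≡⟨ square-suc s ⟨
      (1 + s) * (1 + s)       ≤⟨ ℕ.*-mono-≤ lt lt ⟩
      s′ * s′                 ≤⟨ ℕ.m≤m+n (s′ * s′) m′ ⟩
      s′ * s′ + m′            ∎
      where
      s  = m + n
      s′ = m′ + n′
      square-suc : ∀ k → (1 + k) * (1 + k) ≡ k * k + (1 + (k + k))
      square-suc = solve-∀

  pair-injective : Injective _≡_ _≡_ pair
  pair-injective {m , n} {m′ , n′} eq with ℕ.<-cmp (m + n) (m′ + n′)
  ... | tri< lt _ _ = contradiction eq (ℕ.<⇒≢ (pair-mono m n m′ n′ lt))
  ... | tri> _ _ gt = contradiction (sym eq) (ℕ.<⇒≢ (pair-mono m′ n′ m n gt))
  ... | tri≈ _ same _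
    with refl ← ℕ.+-cancelˡ-≡ ((m + n) * (m + n)) m m′ (trans eq (cong (λ s → s * s + m′) (sym same)))
    = cong (m ,_) (ℕ.+-cancelˡ-≡ m n n′ same)

data OrbitOf {X : Set ℓ} (f : X → X) (A : Pred X ℓ) : Pred X ℓ where
  start : ∀ {x} → x ∈ A → OrbitOf f A x
  next  : ∀ {x} → OrbitOf f A x → OrbitOf f A (f x)

module CardinalProperties (em : ExcludedMiddle ℓ) (κ : Cardinal ℓ) where
  open Cardinal κ public
  open IsStrictTotalOrder isStrictTotalOrder public
    using (asym) renaming (compare to <-cmp; trans to <-trans)

  wellOrder : WellOrder Carrier
  wellOrder = record { _<_ = _<_ ; wellFounded = wellFounded ; connex = connex }
    where
    connex : ∀ x y → x < y ⊎ x ≡ y ⊎ y < x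
    connex x y with <-cmp x y
    ... | tri< x<y _ _ = inj₁ x<y
    ... | tri≈ _ x≡y _ = inj₂ (inj₁ x≡y)
    ... | tri> _ _ y<x = inj₂ (inj₂ y<x)

  open WellOrder wellOrder public using (connex)

  whole : Pred Carrier ℓ
  whole = U

  -- The Cantor–Schröder–Bernstein argument: f on the f-orbits of κ ∖ β and the
  -- identity elsewhere is a bijection of κ with β.
  no-injection-into-segment : ∀ β → ¬ (whole ≼ (_< β))
  no-injection-into-segment β κ≼β = initial β (h , h-< , h-inj , h-surj)
    where
    f : Carrier → Carrier
    f x = to κ≼β {x} _

    Orbit : Pred Carrier ℓ
    Orbit = OrbitOf f (λ x → ¬ (x < β))

    h : Carrier → Carrier
    h x with em {Orbit x}
    ... | yes _ = f x
    ... | no _  = x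

    h-< : ∀ x → h x < β
    h-< x with em {Orbit x}
    ... | yes _ = to-∈ κ≼β {x} _
    ... | no x∉ = decidable-stable em (x∉ ∘ start)

    h-inj : Injective _≡_ _≡_ h
    h-inj {x} {y} eq with em {Orbit x} | em {Orbit y}
    ... | yes _  | yes _  = to-inj κ≼β _ _ eq
    -- `Orbit` is closed under `f`, so `f x` cannot be a point outside it.
    ... | yes x∈ | no y∉  = contradiction (subst Orbit eq (next x∈)) y∉
    ... | no x∉  | yes y∈ = contradiction (subst Orbit (sym eq) (next y∈)) x∉
    ... | no _   | no _   = eq

    h-orbit : ∀ {x} → Orbit x → h x ≡ f x
    h-orbit {x} x∈ with em {Orbit x}
    ... | yes _ = refl
    ... | no x∉ = contradiction x∈ x∉

    h-surj : ∀ {b} → b < β → ∃[ x ] h x ≡ b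
    h-surj {b} b<β with em {Orbit b} in eq
    -- A point of the orbit below `β` is not a starting point, so it is the `f`-value of another
    -- orbit point.
    ... | yes (start b≮β)  = contradiction b<β b≮β
    ... | yes (next {x} o) = x , h-orbit o
    ... | no b∉            = b , h-fixed
      where
      h-fixed : h b ≡ b
      h-fixed rewrite eq = refl

module Hessenberg (em : ExcludedMiddle ℓ) (κ : Cardinal ℓ) (infinite : IsInfinite κ) where
  open CardinalProperties em κ

  private
    e : ℕ → Carrier
    e = Injection.to infinite

    -- A countable subset in the role of the first infinite ordinal; it need not be an initial
    -- segment of `κ`.
    ω : Pred Carrier ℓ
    ω x = ∃[ n ] e n ≡ x

    ω×ω≼ω : (ω ⟨×⟩ ω) ≼ ω
    ω×ω≼ω = record
      { to     = λ ((m , _) , (n , _)) → e (pair (m , n))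
      ; to-∈   = λ _ → _ , refl
      ; to-inj = λ { ((m , refl) , (n , refl)) ((m′ , refl) , (n′ , refl)) eq →
          cong (λ (i , j) → e i , e j) (pair-injective (Injection.injective infinite eq)) }
      }

    infix 4 _≤_
    _≤_ : Rel Carrier ℓ
    x ≤ y = x < y ⊎ x ≡ y

    ≤-trans : ∀ {x y z} → x ≤ y → y ≤ z → x ≤ z
    ≤-trans (inj₂ refl) y≤z         = y≤z
    ≤-trans (inj₁ x<y) (inj₁ y<z)   = inj₁ (<-trans x<y y<z)
    ≤-trans (inj₁ x<y) (inj₂ refl)  = inj₁ x<y

    -- Hilbert's hotel.
    closed≼open : ∀ {δ} → ω ≼ (_< δ) → (_≤ δ) ≼ (_< δ)
    closed≼open {δ} g = record
      { to     = λ p → proj₁ (image p)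
      ; to-∈   = λ p → room-< (proj₂ (image p))
      ; to-inj = λ p q eq →
          room-inj (proj₂ (image p)) (subst (Room _) (sym eq) (proj₂ (image q)))
      }
      where
      c : ℕ → Carrier
      c n = to g (n , refl)

      c-inj : ∀ {m n} → c m ≡ c n → m ≡ n
      c-inj = Injection.injective infinite ∘ to-inj g _ _

      -- The graph of the shift, stated as a relation: a point comes with the case it falls under,
      -- and injectivity is a comparison of cases.
      data Room (x z : Carrier) : Set ℓ where
        top   : x ≡ δ → z ≡ c 0 → Room x z
        shift : ∀ n → x ≡ c n → z ≡ c (ℕ.suc n) → Room x z
        stay  : ¬ (∃[ n ] x ≡ c n) → x < δ → z ≡ x → Room x z

      image : ∀ {x} → x ≤ δ → ∃[ z ] Room x z
      image (inj₂ x≡δ) = _ , top x≡δ refl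
      image {x} (inj₁ x<δ) with em {∃[ n ] x ≡ c n}
      ... | yes (n , eq) = _ , shift n eq refl
      ... | no x∉        = _ , stay x∉ x<δ refl

      room-< : ∀ {x z} → Room x z → z < δ
      room-< (top _ refl)     = to-∈ g _
      room-< (shift _ _ refl) = to-∈ g _
      room-< (stay _ x<δ refl) = x<δ

      room-inj : ∀ {x y z} → Room x z → Room y z → x ≡ y
      room-inj (top refl _) (top refl _) = refl
      room-inj (top _ refl) (shift _ _ eq) = contradiction (c-inj eq) λ ()
      room-inj (top _ refl) (stay y∉ _ refl) = contradiction (_ , refl) y∉
      room-inj (shift _ _ refl) (top _ eq) = contradiction (c-inj eq) λ ()
      room-inj (shift _ refl refl) (shift _ refl eq) = cong c (ℕ.suc-injective (c-inj eq))
      room-inj (shift _ _ refl) (stay y∉ _ refl) = contradiction (_ , refl) y∉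
      room-inj (stay x∉ _ refl) (top _ refl) = contradiction (_ , refl) x∉
      room-inj (stay x∉ _ refl) (shift _ _ refl) = contradiction (_ , refl) x∉
      room-inj (stay _ _ refl) (stay _ _ refl) = refl

    max : Carrier × Carrier → Carrier
    max (x , y) with connex x y
    ... | inj₁ _ = y
    ... | inj₂ _ = x

    max-upper : ∀ x y → x ≤ max (x , y) × y ≤ max (x , y)
    max-upper x y with connex x y
    ... | inj₁ x<y        = inj₁ x<y , inj₂ refl
    ... | inj₂ (inj₁ x≡y) = inj₂ refl , inj₂ (sym x≡y)
    ... | inj₂ (inj₂ y<x) = inj₂ refl , inj₁ y<x

    max-∈ : ∀ {S : Pred Carrier ℓ} {w} → w ∈ (S ⟨×⟩ S) → max w ∈ S
    max-∈ {w = x , y} (x∈S , y∈S) with connex x y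
    ... | inj₁ _ = y∈S
    ... | inj₂ _ = x∈S

    -- Maxima are compared first so that the segment below `w` stays inside the square on `max w`; a
    -- plain lexicographic segment can contain entire rows.
    gödel : WellOrder (Carrier × Carrier)
    gödel = pullback (λ w → max w , w) ,-injectiveʳ
              (lexicographic wellOrder (lexicographic wellOrder wellOrder))

    module G = WellOrder gödel

    segment⊆square : ∀ {w} → (G._< w) ⊆ ((_≤ max w) ⟨×⟩ (_≤ max w))
    segment⊆square {w} {x , y} v<w = ≤-trans x≤ max≤ , ≤-trans y≤ max≤
      where
      x≤ = proj₁ (max-upper x y)
      y≤ = proj₂ (max-upper x y)
      max≤ : max (x , y) ≤ max w
      max≤ = [ inj₁ , inj₂ ∘ proj₁ ]′ v<w

    -- By the Gödel order, S² embeds into S unless S embeds into some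
    -- (_≤ δ) ⟨×⟩ (_≤ δ) with δ ∈ S, which is countable or of the size of δ.
    square≼-step : (S : Pred Carrier ℓ) → ω ≼ S →
                   (∀ {δ} → δ ∈ S → ¬ (S ≼ (_< δ))) →
                   (∀ {δ} → δ ∈ S → ω ≼ (_< δ) → ((_< δ) ⟨×⟩ (_< δ)) ≼ (_< δ)) →
                   (S ⟨×⟩ S) ≼ S
    square≼-step S ω≼S S⋠δ δ×δ≼δ with em {S ≼ ω}
    ... | yes S≼ω = ≼-trans (square-mono S≼ω) (≼-trans ω×ω≼ω ω≼S)
    ... | no  S⋠ω with Comparison.compare em gödel wellOrder (e 0) (S ⟨×⟩ S) S
    ...   | inj₁ S×S≼S = S×S≼S
    ...   | inj₂ (w , w∈S×S , S≼seg) =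
      ⊥-elim (impossible (Comparison.compare em wellOrder wellOrder (e 0) (_≤ δ) ω))
      where
      δ : Carrier
      δ = max w

      δ∈S : δ ∈ S
      δ∈S = max-∈ {S} w∈S×S

      S≼δ² : S ≼ ((_≤ δ) ⟨×⟩ (_≤ δ))
      S≼δ² = ≼-trans S≼seg (⊆⇒≼ (segment⊆square ∘ proj₂))

      impossible : ¬ ((_≤ δ) ≼ ω ⊎ ∃[ x ] x ≤ δ × ω ≼ (_≤ δ) ∩ (_< x))
      impossible (inj₁ δ≼ω) = S⋠ω (≼-trans S≼δ² (≼-trans (square-mono δ≼ω) ω×ω≼ω))
      -- With a copy of `ω` below `δ`, the hotel moves `(_≤ δ)` into `(_< δ)`, whose square is
      -- controlled by hypothesis; so `S` would embed below `δ`.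
      impossible (inj₂ (x , x≤δ , ω≼x)) =
        S⋠δ δ∈S (≼-trans S≼δ² (≼-trans (square-mono (closed≼open ω≼δ)) (δ×δ≼δ δ∈S ω≼δ)))
        where
        <-≤-trans : ∀ {y} → y < x → x ≤ δ → y < δ
        <-≤-trans y<x (inj₁ x<δ)  = <-trans y<x x<δ
        <-≤-trans y<x (inj₂ refl) = y<x

        ω≼δ : ω ≼ (_< δ)
        ω≼δ = ≼-trans ω≼x (⊆⇒≼ (λ (_ , y<x) → <-≤-trans y<x x≤δ))

    Square≼ : Pred Carrier ℓ
    Square≼ β = ω ≼ (_< β) → ((_< β) ⟨×⟩ (_< β)) ≼ (_< β)

    -- Well-founded induction. If the segment below `β` embeds into one below a smaller `γ`, the
    -- claim is inherited from `γ`; otherwise `β` is itself initial and `square≼-step` applies.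
    segment-square≼ : ∀ β → Square≼ β
    segment-square≼ = All.wfRec wellFounded ℓ Square≼ step
      where
      step : ∀ β → WfRec _<_ Square≼ β → Square≼ β
      step β rec ω≼β with em {∃[ γ ] γ < β × (_< β) ≼ (_< γ)}
      ... | yes (γ , γ<β , β≼γ) =
        ≼-trans (square-mono β≼γ) (≼-trans (rec γ<β (≼-trans ω≼β β≼γ)) (⊆⇒≼ λ x<γ → <-trans x<γ γ<β))
      ... | no β-initial =
        square≼-step (_< β) ω≼β (λ δ<β β≼δ → β-initial (_ , δ<β , β≼δ)) (λ δ<β → rec δ<β)

  square≼ : (whole ⟨×⟩ whole) ≼ whole
  square≼ = square≼-step whole (⊆⇒≼ _) (λ {δ} _ → no-injection-into-segment δ) (λ {δ} _ → segment-square≼ δ)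

  -- A left inverse of the embedding of the square, with an arbitrary value off its range.
  -- Surjectivity is what covers call for: each pair of indices must be coded by some single index.
  unpair : Σ[ u ∈ (Carrier → Carrier × Carrier) ] (∀ w → ∃[ x ] u x ≡ w)
  unpair = u , λ w → j w , u-j w
    where
    j : Carrier × Carrier → Carrier
    j w = to square≼ {w} _

    u : Carrier → Carrier × Carrier
    u x with em {∃[ w ] j w ≡ x}
    ... | yes (w , _) = w
    ... | no _        = x , x

    u-j : ∀ w → u (j w) ≡ w
    u-j w with em {∃[ w′ ] j w′ ≡ j w}
    ... | yes (w′ , eq) = to-inj square≼ _ _ eq
    ... | no none       = contradiction (w , refl) none

-- Regular cardinals

module Regular (em : ExcludedMiddle ℓ) (θ : Cardinal ℓ) (regular : IsRegular θ) where
  open CardinalProperties em θ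

  Unbounded : Pred Carrier ℓ → Set ℓ
  Unbounded T = ∀ γ → ∃[ t ] t ∈ T × ¬ (t < γ)

  ¬unbounded⇒bounded : ∀ {T} → ¬ Unbounded T → ∃[ γ ] (∀ {t} → t ∈ T → t < γ)
  ¬unbounded⇒bounded {T} ¬unb = decidable-stable (em {∃[ γ ] (∀ {t} → t ∈ T → t < γ)}) λ none → ¬unb λ γ →
    decidable-stable em λ below → none (γ , λ {t} t∈T → decidable-stable em λ t≮γ → below (t , t∈T , t≮γ))

  -- If `θ` did not embed into `T`, then `T` would embed into the segment below some `x`. The
  -- inverse, extended arbitrarily to a total map, would send that segment cofinally into `θ`,
  -- against regularity.
  unbounded⇒full : ∀ {T} → Unbounded T → whole ≼ T
  unbounded⇒full {T} unb
    with Comparison.compare em wellOrder wellOrder (Injection.to (proj₁ regular) 0) whole T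
  ... | inj₁ θ≼T = θ≼T
  ... | inj₂ (x , _ , T≼x) =
    contradiction (subst (_< γ) (f-to t∈T) (f-bounded (proj₂ (to-∈ T≼x t∈T)))) t≮γ
    where
    f : Carrier → Carrier
    f ξ with em {∃[ t ] Σ[ t∈T ∈ t ∈ T ] to T≼x t∈T ≡ ξ}
    ... | yes (t , _) = t
    ... | no _        = ξ

    f-to : ∀ {t} (t∈T : t ∈ T) → f (to T≼x t∈T) ≡ t
    f-to t∈T with em {∃[ s ] Σ[ s∈T ∈ s ∈ T ] to T≼x s∈T ≡ to T≼x t∈T}
    ... | yes (_ , s∈T , eq) = to-inj T≼x s∈T t∈T eq
    ... | no none            = contradiction (_ , t∈T , refl) none

    γ : Carrier
    γ = proj₁ (proj₂ regular x f)

    f-bounded : ∀ {ξ} → ξ < x → f ξ < γ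
    f-bounded = proj₂ (proj₂ regular x f)

    t∈T : proj₁ (unb γ) ∈ T
    t∈T = proj₁ (proj₂ (unb γ))

    t≮γ : ¬ (proj₁ (unb γ) < γ)
    t≮γ = proj₂ (proj₂ (unb γ))

  module _ (S : Setoid ℓ ℓ) where
    private module S = Setoid S

    -- An unbounded fibre has full size and `g` is constant on it. If every fibre is bounded, the
    -- least points of the fibres form a set on which `g` is injective, and regularity makes this
    -- set unbounded.
    constant-or-injective : (g : Carrier → S.Carrier) →
      (∃[ c ] whole ≼ (λ i → g i S.≈ c)) ⊎
      (Σ[ T ∈ Pred Carrier ℓ ] whole ≼ T × (∀ {i j} → i ∈ T → j ∈ T → g i S.≈ g j → i ≡ j))
    constant-or-injective g with em {∃[ i ] Unbounded (λ j → g j S.≈ g i)}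
    ... | yes (i , unb)    = inj₁ (g i , unbounded⇒full unb)
    ... | no small-fibres = inj₂ (First , unbounded⇒full First-unbounded , First-injective)
      where
      First : Pred Carrier ℓ
      First i = ∀ {j} → j < i → ¬ (g j S.≈ g i)

      First-injective : ∀ {i j} → i ∈ First → j ∈ First → g i S.≈ g j → i ≡ j
      First-injective {i} {j} i∈ j∈ eq with connex i j
      ... | inj₁ i<j        = contradiction eq (j∈ i<j)
      ... | inj₂ (inj₁ i≡j) = i≡j
      ... | inj₂ (inj₂ j<i) = contradiction (S.sym eq) (i∈ j<i)

      fibre-bound : ∀ i → ∃[ γ ] (∀ {j} → g j S.≈ g i → j < γ)
      fibre-bound i = ¬unbounded⇒bounded λ unb → small-fibres (i , unb)

      -- If First were contained in γ, then the fibres of the values g ξ with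
      -- ξ < γ would cover θ, although they have a common bound.
      First-unbounded : Unbounded First
      First-unbounded = decidable-stable em λ ¬unb →
        let (γ , First<γ) = ¬unbounded⇒bounded ¬unb
            (δ , bound<δ) = proj₂ regular γ (proj₁ ∘ fibre-bound)
            (m , gm≈gδ , m-min) = least-exists {λ j → g j S.≈ g δ} S.refl
            m<γ = First<γ λ {j} j<m gj≈gm → m-min j<m (S.trans gj≈gm gm≈gδ)
        in asym (bound<δ m<γ) (proj₂ (fibre-bound m) (S.sym gm≈gδ))
        where open Least em wellOrder (Injection.to (proj₁ regular) 0)

-- Linked sets

module _ {ℓ} (P : Poset ℓ ℓ ℓ) where
  open Poset P using (Carrier; _≤_; _≈_; module Eq)
  open Forcing P

  Linked-⊆ : ∀ {F} Q R → Q ⊆ R → Linked F R → Linked F Q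
  Linked-⊆ _ _ Q⊆R linked p p∈Q = linked p (Q⊆R ∘ p∈Q)

  -- The condition `c` forces every `p n` into the generic filter, and each member of a filter has
  -- an element `n`.
  Linked-singleton : ExcludedMiddle ℓ → ∀ {F} → IsFilter F → ∀ c → Linked F (_≈ c)
  Linked-singleton em isFilter c p p≈c = c , λ a a∈F {r} r≤c →
    let (n , n∈a) = decidable-stable em λ none → IsFilter.proper isFilter (λ n n∈a → none (n , n∈a)) a∈F
    in r , P.refl , n , n∈a , λ {s} s≤r → s , P.refl , P.trans s≤r (P.trans r≤c (P.reflexive (Eq.sym (p≈c n))))
    where module P = Poset P

  Compatible : Carrier → Carrier → Set ℓ
  Compatible r p = ∃[ s ] s ≤ r × s ≤ p

  compatible-∈D : ∀ {D p q r} → IsNonPrincipalUltrafilter D → q ⊩ Ẇ p ∈⁺ D → r ≤ q →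
                  (λ n → Compatible r (p n)) ∈ D
  compatible-∈D {p = p} {r = r} uf q⊩ r≤q
    with IsNonPrincipalUltrafilter.ultra uf (λ n → Compatible r (p n))
  ... | inj₁ ∈D = ∈D
  ... | inj₂ ∁∈D =
    -- If the complement were in `D`, some extension of `r` would force `p n` into the generic
    -- filter for an `n` with `p n` incompatible with `r`.
    let (s , s≤r , n , n∉ , s⊩) = q⊩ _ ∁∈D r≤q
        (t , t≤s , t≤pn) = s⊩ (Poset.refl P)
    in contradiction (t , Poset.trans P t≤s s≤r , t≤pn) n∉

-- The Knaster property for families with repetitions, as a coordinate of an injective family may
-- repeat values. The result is an injective reindexing, so that it can be composed with the one for
-- the other coordinate.
Knaster-reindex : ExcludedMiddle ℓ → ∀ {a} (P : Poset ℓ ℓ ℓ) {𝓛 : Pred (Pred (Poset.Carrier P) ℓ) a} →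
  (∀ c → (λ p → Poset._≈_ P p c) ∈ 𝓛) →
  (θ : Cardinal ℓ) → IsRegular θ → Forcing.Knaster P θ 𝓛 →
  (g : Cardinal.Carrier θ → Poset.Carrier P) →
  ∃[ B ] B ∈ 𝓛 × Σ[ t ∈ (Cardinal.Carrier θ → Cardinal.Carrier θ) ]
    Injective _≡_ _≡_ t × (∀ i → g (t i) ∈ B)
Knaster-reindex em P singleton θ regular knaster g
  with Regular.constant-or-injective em θ regular (Poset.Eq.setoid P) g
... | inj₁ (c , θ≼) =
  _ , singleton c , (λ i → to θ≼ {i} _) , to-inj θ≼ _ _ , λ i → to-∈ θ≼ {i} _
... | inj₂ (T , θ≼T , g-inj) =
  let s = λ i → to θ≼T {i} _
      (B , B⊆ , (h , h∈B , h-inj , _) , B∈𝓛) =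
        knaster (λ p → ∃[ i ] g (s i) ≡ p)
          ( g ∘ s , (λ i → i , refl)
          , (λ eq → to-inj θ≼T _ _ (g-inj (to-∈ θ≼T _) (to-∈ θ≼T _) eq))
          , λ (i , eq) → i , Poset.Eq.reflexive P eq)
      index = λ j → B⊆ (h∈B j)
  in B , B∈𝓛 , (λ j → s (proj₁ (index j))) ,
     -- The map `g` sends the new index of `j` back to `h j`, so equal indices give equal values of
     -- `h`.
     (λ {j} {k} eq → h-inj (Poset.Eq.reflexive P
        (trans (sym (proj₂ (index j))) (trans (cong g eq) (proj₂ (index k)))))) ,
     λ j → subst (_∈ B) (sym (proj₂ (index j))) (h∈B j)

-- Products of two posets

module _ {ℓ} (em : ExcludedMiddle ℓ) (P₀ P₁ : Poset ℓ ℓ ℓ) where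
  private
    module P₀ = Poset P₀
    module P₁ = Poset P₁
    module F₀ = Forcing P₀
    module F₁ = Forcing P₁
    module F = Forcing (×-poset P₀ P₁)

  Linked-× : ∀ {D} → IsNonPrincipalUltrafilter D → ∀ Q₀ Q₁ →
             F₀.Linked D Q₀ → F₁.Linked D Q₁ → F.Linked D (Q₀ ⟨×⟩ Q₁)
  Linked-× uf _ _ linked₀ linked₁ p p∈ =
    let (q₀ , q₀⊩) = linked₀ (proj₁ ∘ p) (proj₁ ∘ p∈)
        (q₁ , q₁⊩) = linked₁ (proj₂ ∘ p) (proj₂ ∘ p∈)
    in (q₀ , q₁) , λ a a∈D (r₀≤q₀ , r₁≤q₁) →
      let both = ∩-closed a∈D (∩-closed (compatible-∈D P₀ uf q₀⊩ r₀≤q₀) (compatible-∈D P₁ uf q₁⊩ r₁≤q₁))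
          (n , n∈a , (s₀ , s₀≤r₀ , s₀≤p) , (s₁ , s₁≤r₁ , s₁≤p)) =
            decidable-stable em λ none → proper (λ n n∈ → none (n , n∈)) both
      in (s₀ , s₁) , (s₀≤r₀ , s₁≤r₁) , n , n∈a ,
         λ {t} (t₀≤s₀ , t₁≤s₁) → t , (P₀.refl , P₁.refl) , (P₀.trans t₀≤s₀ s₀≤p , P₁.trans t₁≤s₁ s₁≤p)
    where open IsFilter (IsNonPrincipalUltrafilter.isFilter uf)

  -- The classes stand for `Linked D` or for `UfLinked`. Abstracting over them treats both at once;
  -- the uf-versions do not follow ultrafilter by ultrafilter, since one cover or one subset has to
  -- serve all of them.
  module _ {a} (𝓛₀ : Pred (Pred P₀.Carrier ℓ) a) (𝓛₁ : Pred (Pred P₁.Carrier ℓ) a)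
           (𝓛 : Pred (Pred (P₀.Carrier × P₁.Carrier) ℓ) a)
           (𝓛-× : ∀ Q₀ Q₁ → Q₀ ∈ 𝓛₀ → Q₁ ∈ 𝓛₁ → (Q₀ ⟨×⟩ Q₁) ∈ 𝓛) where

    CoveredBy-× : (μ : Cardinal ℓ) → IsInfinite μ →
                  F₀.CoveredBy μ 𝓛₀ → F₁.CoveredBy μ 𝓛₁ → F.CoveredBy μ 𝓛
    CoveredBy-× μ infinite (Q₀ , Q₀∈ , cover₀) (Q₁ , Q₁∈ , cover₁) =
      (λ k → Q₀ (proj₁ (u k)) ⟨×⟩ Q₁ (proj₂ (u k))) ,
      (λ k → 𝓛-× _ _ (Q₀∈ _) (Q₁∈ _)) ,
      λ (p₀ , p₁) →
        let (i , p₀∈) = cover₀ p₀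
            (j , p₁∈) = cover₁ p₁
            (k , uk≡) = u-surj (i , j)
        in k , subst (λ w → (p₀ , p₁) ∈ (Q₀ (proj₁ w) ⟨×⟩ Q₁ (proj₂ w))) (sym uk≡) (p₀∈ , p₁∈)
      where
      u      = proj₁ (Hessenberg.unpair em μ infinite)
      u-surj = proj₂ (Hessenberg.unpair em μ infinite)

    Knaster-× : (∀ c → (P₀._≈ c) ∈ 𝓛₀) → (∀ c → (P₁._≈ c) ∈ 𝓛₁) →
                (∀ Q R → Q ⊆ R → R ∈ 𝓛 → Q ∈ 𝓛) →
                (θ : Cardinal ℓ) → IsRegular θ →
                F₀.Knaster θ 𝓛₀ → F₁.Knaster θ 𝓛₁ → F.Knaster θ 𝓛
    Knaster-× singleton₀ singleton₁ 𝓛-⊆ θ regular knaster₀ knaster₁ A (f , f∈A , f-inj , _) =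
      let (B₀ , B₀∈ , s , s-inj , s∈B₀) =
            Knaster-reindex em P₀ singleton₀ θ regular knaster₀ (proj₁ ∘ f)
          (B₁ , B₁∈ , t , t-inj , t∈B₁) =
            Knaster-reindex em P₁ singleton₁ θ regular knaster₁ (proj₂ ∘ f ∘ s)
          g = f ∘ s ∘ t
      -- The witness is the range of `g` and not `B₀ ⟨×⟩ B₁`, which may leave `A`; it inherits
      -- membership in `𝓛` as a subset of that product.
      in (λ p → ∃[ i ] g i ≡ p) ,
         (λ { (i , refl) → f∈A _ }) ,
         (g , (λ i → i , refl) , (λ eq → t-inj (s-inj (f-inj eq)))
            , λ { (i , refl) → i , P₀.Eq.refl , P₁.Eq.refl }) ,
         𝓛-⊆ _ (B₀ ⟨×⟩ B₁) (λ { (i , refl) → s∈B₀ (t i) , t∈B₁ i }) (𝓛-× B₀ B₁ B₀∈ B₁∈)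

theorem3p19 : ∀ {ℓ : Level} → ExcludedMiddle (suc ℓ) →
  (ℚ₀ ℚ₁ : Poset ℓ ℓ ℓ) →
  let module P₀ = Forcing ℚ₀
      module P₁ = Forcing ℚ₁
      module P = Forcing (×-poset ℚ₀ ℚ₁)
  in
  (∀ (D₀ : Family ℓ) → IsNonPrincipalUltrafilter D₀ →
      (∀ (Q₀ : Pred (Poset.Carrier ℚ₀) ℓ) (Q₁ : Pred (Poset.Carrier ℚ₁) ℓ) →
         P₀.Linked D₀ Q₀ → P₁.Linked D₀ Q₁ → P.Linked D₀ (Q₀ ⟨×⟩ Q₁))
    × (∀ (μ : Cardinal ℓ) → IsInfinite μ →
         P₀.μ-Linked μ D₀ → P₁.μ-Linked μ D₀ → P.μ-Linked μ D₀)
    × (∀ (θ : Cardinal ℓ) → IsRegular θ →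
         P₀.θ-Knaster θ D₀ → P₁.θ-Knaster θ D₀ → P.θ-Knaster θ D₀))
  ×
  ( (∀ (Q₀ : Pred (Poset.Carrier ℚ₀) ℓ) (Q₁ : Pred (Poset.Carrier ℚ₁) ℓ) →
       P₀.UfLinked Q₀ → P₁.UfLinked Q₁ → P.UfLinked (Q₀ ⟨×⟩ Q₁))
  × (∀ (μ : Cardinal ℓ) → IsInfinite μ →
       P₀.μ-UfLinked μ → P₁.μ-UfLinked μ → P.μ-UfLinked μ)
  × (∀ (θ : Cardinal ℓ) → IsRegular θ →
       P₀.θ-UfKnaster θ → P₁.θ-UfKnaster θ → P.θ-UfKnaster θ))
theorem3p19 em⁺ ℚ₀ ℚ₁ =
    (λ D uf →
        Linked-× em ℚ₀ ℚ₁ uf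
      , CoveredBy-× em ℚ₀ ℚ₁ (P₀.Linked D) (P₁.Linked D) (P.Linked D) (Linked-× em ℚ₀ ℚ₁ uf)
      , Knaster-× em ℚ₀ ℚ₁ (P₀.Linked D) (P₁.Linked D) (P.Linked D) (Linked-× em ℚ₀ ℚ₁ uf)
          (Linked-singleton ℚ₀ em (isFilter uf))
          (Linked-singleton ℚ₁ em (isFilter uf))
          (Linked-⊆ (×-poset ℚ₀ ℚ₁)))
  , UfLinked-×
  , CoveredBy-× em ℚ₀ ℚ₁ P₀.UfLinked P₁.UfLinked P.UfLinked UfLinked-×
  , Knaster-× em ℚ₀ ℚ₁ P₀.UfLinked P₁.UfLinked P.UfLinked UfLinked-×
      (λ c D uf → Linked-singleton ℚ₀ em (isFilter uf) c)
      (λ c D uf → Linked-singleton ℚ₁ em (isFilter uf) c)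
      (λ Q R Q⊆R linked D uf → Linked-⊆ (×-poset ℚ₀ ℚ₁) Q R Q⊆R (linked D uf))
  where
  open IsNonPrincipalUltrafilter using (isFilter)
  module P₀ = Forcing ℚ₀
  module P₁ = Forcing ℚ₁
  module P = Forcing (×-poset ℚ₀ ℚ₁)

  em = lower-em em⁺

  UfLinked-× : ∀ Q₀ Q₁ → P₀.UfLinked Q₀ → P₁.UfLinked Q₁ → P.UfLinked (Q₀ ⟨×⟩ Q₁)
  UfLinked-× Q₀ Q₁ linked₀ linked₁ D uf = Linked-× em ℚ₀ ℚ₁ uf Q₀ Q₁ (linked₀ D uf) (linked₁ D uf)
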